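{- Let $\mathbf{ftm}$ be the Fibonacci-Thue-Morse sequence, let $\rho(n)$ denote the number of distinct length-$n$ contiguous blocks (factors) of $\mathbf{ftm}$, and let $d(n) = \rho(n+1) - \rho(n)$ for $n \ge 0$. Then for every integer $m \geq 2$: \begin{align*} d(n) &= 8 \text{ for } F_{2m+1} + 2 \leq n \leq F_{2m+1} + F_{2m-2} + 1, \\ d(n) &= 6 \text{ for } F_{2m+1} + F_{2m-2} + 2 \leq n \leq F_{2m+2}, \\ d(n) &= 8 \text{ for } F_{2m+2} + 1 \leq n \leq F_{2m+2} + F_{2m-1}, \\ d(n) &= 6 \text{ for } F_{2m+2} + F_{2m-1} + 1 \leq n \leq F_{2m+3} + 1. \end{align*}
   Context: The Fibonacci numbers are defined by $F_0 = 0$, $F_1 = 1$, $F_n = F_{n-1} + F_{n-2}$. Every natural number $n$ has a unique Fibonacci (Zeckendorf) representation: a binary word $w = w[1]\cdots w[t]$ with $w[1] = 1$ (if $t \ge 1$; the representation of $0$ is the empty word), with no two consecutive $1$'s, and with $n = \sum_{i=1}^{t} w[i] F_{t+2-i}$. The Fibonacci-Thue-Morse sequence $(\mathbf{ftm}[n])_{n \ge 0}$ is defined by letting $\mathbf{ftm}[n]$ be the sum, modulo $2$, of the bits of the Fibonacci representation of $n$ (so it begins $0,1,1,1,0,1,0,0,1,0,0,0,1,1,0,0,0,1,0,1,\ldots$). Equivalently, $d(n)$ is the number of length-$n$ factors $x$ of $\mathbf{ftm}$ such that both $x0$ and $x1$ are factors of $\mathbf{ftm}$. -}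

module Defs where

open import Data.Nat using (ℕ; zero; suc; _+_)
open import Data.Bool using (Bool; true; false; if_then_else_; _xor_)
open import Data.List using (List; []; _∷_; length)
open import Data.List.Relation.Unary.Unique.Propositional using (Unique)
open import Data.List.Membership.Propositional using (_∈_)
open import Data.Vec using (Vec; lookup)
open import Data.Fin using (Fin; toℕ)
open import Data.Product using (Σ; ∃; _×_)
open import Data.Unit using (⊤)
open import Data.Empty using (⊥)
open import Function.Bundles using (_⇔_)
open import Relation.Binary.PropositionalEquality using (_≡_)

fib : ℕ → ℕ
fib zero = zero
fib (suc zero) = suc zero
fib (suc (suc n)) = fib (suc n) + fib n

-- value of a binary word w[1..t]: Σ w[i] F_{t+2-i}
-- (the bit followed by a suffix of length r has weight F_{r+2})
fibVal : List Bool → ℕ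
fibVal [] = zero
fibVal (b ∷ w) = (if b then fib (suc (suc (length w))) else zero) + fibVal w

LeadingOne : List Bool → Set
LeadingOne [] = ⊤
LeadingOne (b ∷ _) = b ≡ true

NoConsecutiveOnes : List Bool → Set
NoConsecutiveOnes [] = ⊤
NoConsecutiveOnes (true ∷ true ∷ _) = ⊥
NoConsecutiveOnes (_ ∷ w) = NoConsecutiveOnes w

IsFibRep : ℕ → List Bool → Set
IsFibRep n w = LeadingOne w × NoConsecutiveOnes w × (n ≡ fibVal w)

bitParity : List Bool → Bool
bitParity [] = false
bitParity (b ∷ w) = b xor bitParity w

-- ftm[n] = b  (bits encoded as Bool, false = 0, true = 1)
Ftm : ℕ → Bool → Set
Ftm n b = Σ (List Bool) λ w → IsFibRep n w × (bitParity w ≡ b)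

IsFactor : {ℓ : ℕ} → Vec Bool ℓ → Set
IsFactor {ℓ} x = ∃ λ i → (j : Fin ℓ) → Ftm (i + toℕ j) (lookup x j)

-- ρ(n) = k : the set of length-n factors of ftm has exactly k elements
-- (witnessed by a duplicate-free list enumerating exactly those factors)
FactorCount : ℕ → ℕ → Set
FactorCount n k =
  Σ (List (Vec Bool n)) λ L →
    Unique L × (length L ≡ k) × ((x : Vec Bool n) → (x ∈ L) ⇔ IsFactor x)

DiffEq : ℕ → ℕ → Set
DiffEq n c = ∃ λ k → FactorCount n k × FactorCount (suc n) (k + c)

-- Let X_j be the prefix of ftm of length F_j and ~ the complement, so that X_{j+1} = X_j ~X_{j-1}.
--
-- Lower bound. The increment ρ(n+1) − ρ(n) is at least the number of left special factors of length n.
-- Six of them always exist: P, 0P, 1P and their complements, where P is a prefix of ftm, because every X_j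
-- is followed by ~P for some long P and the last two letters of X_j take all four values, with period 4 in j.
-- The word X_K X_{K-3} leaves the prefixes of ftm after X_K. It follows both ~X_K and X_{K-1}, which end
-- differently if K is even, and agree in the last letter but not in the one before it if K is odd. This
-- gives two more left special factors, for F_{K-3} consecutive lengths.
--
-- Upper bound. Up to complement, a window of length F_K + 1 is a window that starts at most F_K places
-- before F_J for some J = K+1, …, K+4. Removing the obvious repetitions leaves 8 F_K − 2 F_{K-1} − 4 words.
--
-- The lower bounds for the increments add up to exactly this number, so all of them are equalities.

module Submission where

open import Defs
open import Data.Bool using (Bool; true; false; not; if_then_else_; _xor_)
open import Data.Bool.Properties using (not-involutive; not-¬; ¬-not; not-distribˡ-xor; xor-assoc) renaming (_≟_ to _≟ᵇ_)
open import Data.Empty using (⊥-elim)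
open import Data.Fin using (toℕ; zero; suc)
open import Data.List using (List; []; _∷_; _++_; length; map; applyUpTo; upTo; cartesianProduct; deduplicate)
open import Data.List.Membership.Propositional using (_∈_)
open import Data.List.Membership.Propositional.Properties
import Data.List.Membership.DecPropositional as DecMembership
open import Data.List.Properties using (length-++; length-applyUpTo; length-map)
open import Data.List.Relation.Unary.All as All using ([]; _∷_)
open import Data.List.Relation.Unary.AllPairs using ([]; _∷_)
open import Data.List.Relation.Unary.Any using (here; there)
open import Data.List.Relation.Unary.Unique.Propositional using (Unique)
import Data.List.Relation.Unary.Unique.Propositional.Properties as Unique
open import Data.List.Relation.Unary.Unique.DecPropositional.Properties using (deduplicate-!)
open import Data.Maybe using (Maybe; just; nothing)
open import Data.Nat using (ℕ; zero; suc; _+_; _*_; _∸_; _≤_; _<_; z≤n; s≤s; _<?_; _≤?_)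
open import Data.Nat.Properties
open import Data.Nat.Solver using (module +-*-Solver)
open import Data.Product using (∃; ∃₂; _×_; _,_; proj₁; proj₂)
open import Data.Sum using (_⊎_; inj₁; inj₂)
open import Data.Unit using (tt)
open import Data.Vec using (Vec; []; _∷_; lookup; tabulate)
open import Data.Vec.Properties using (tabulate∘lookup; tabulate-cong; ∷-injectiveˡ; ∷-injectiveʳ; ≡-dec)
open import Function using (_∘_)
open import Function.Bundles using (mk⇔)
open import Relation.Binary using (DecidableEquality)
open import Relation.Binary.PropositionalEquality using (_≡_; _≢_; refl; sym; trans; cong; cong₂; subst; subst₂; module ≡-Reasoning)
open import Relation.Nullary using (¬_; yes; no)
open import Relation.Nullary.Decidable using (does; dec-true; dec-false)

-- Fibonacci numbers and the recursion for `ftm`.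

fib-pos : ∀ k → 1 ≤ fib (suc k)
fib-pos zero    = ≤-refl
fib-pos (suc k) = ≤-trans (fib-pos k) (m≤m+n _ _)

fib-≤-suc : ∀ k → fib k ≤ fib (suc k)
fib-≤-suc zero    = z≤n
fib-≤-suc (suc k) = m≤m+n _ _

fib-≤-+ : ∀ d k → fib k ≤ fib (d + k)
fib-≤-+ zero    k = ≤-refl
fib-≤-+ (suc d) k = ≤-trans (fib-≤-+ d k) (fib-≤-suc (d + k))

fib-mono : ∀ {k l} → k ≤ l → fib k ≤ fib l
fib-mono {k} {l} k≤l = subst (λ j → fib k ≤ fib j) (m∸n+n≡m k≤l) (fib-≤-+ (l ∸ k) k)

n<fib[2+n] : ∀ n → n < fib (2 + n)
n<fib[2+n] zero    = ≤-refl
n<fib[2+n] (suc n) = subst (_≤ fib (3 + n)) (+-comm (suc n) 1) (+-mono-≤ (n<fib[2+n] n) (fib-pos n))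

-- Only the values at n < fib k are meaningful.
ftmBelow : ℕ → ℕ → Bool
ftmBelow (suc (suc k)) n =
  if does (n <? fib (suc k)) then ftmBelow (suc k) n else not (ftmBelow k (n ∸ fib (suc k)))
ftmBelow _ _ = false

ftm : ℕ → Bool
ftm n = ftmBelow (2 + n) n

ftmBelow-suc : ∀ k {n} → n < fib k → ftmBelow (suc k) n ≡ ftmBelow k n
ftmBelow-suc (suc k) {n} n<
  rewrite dec-true (n <? fib (suc k)) n< = refl

ftmBelow-high : ∀ k r → ftmBelow (2 + k) (fib (suc k) + r) ≡ not (ftmBelow k r)
ftmBelow-high k r
  rewrite dec-false (fib (suc k) + r <? fib (suc k)) (≤⇒≯ (m≤m+n _ r)) | m+n∸m≡n (fib (suc k)) r = refl

ftmBelow-+ : ∀ d k {n} → n < fib k → ftmBelow (d + k) n ≡ ftmBelow k n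
ftmBelow-+ zero    k n< = refl
ftmBelow-+ (suc d) k n< =
  trans (ftmBelow-suc (d + k) (<-≤-trans n< (fib-≤-+ d k))) (ftmBelow-+ d k n<)

ftmBelow≡ftm : ∀ k {n} → n < fib k → ftmBelow k n ≡ ftm n
ftmBelow≡ftm k {n} n< with ≤-total k (2 + n)
... | inj₁ le = sym (subst (λ j → ftmBelow j n ≡ ftmBelow k n) (m∸n+n≡m le) (ftmBelow-+ (2 + n ∸ k) k n<))
... | inj₂ ge = subst (λ j → ftmBelow j n ≡ ftm n) (m∸n+n≡m ge) (ftmBelow-+ (k ∸ (2 + n)) (2 + n) (n<fib[2+n] n))

-- The identity X_{k+2} = X_{k+1} ~X_k, letter by letter. Nearly everything about `ftm` below rests
-- on it.
ftm-fib+ : ∀ k {r} → r < fib k → ftm (fib (suc k) + r) ≡ not (ftm r)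
ftm-fib+ k {r} r< = begin
  ftm (fib (suc k) + r)              ≡⟨ ftmBelow≡ftm (2 + k) (+-monoʳ-< (fib (suc k)) r<) ⟨
  ftmBelow (2 + k) (fib (suc k) + r) ≡⟨ ftmBelow-high k r ⟩
  not (ftmBelow k r)                 ≡⟨ cong not (ftmBelow≡ftm k r<) ⟩
  not (ftm r)                        ∎
  where open ≡-Reasoning

-- Fibonacci representations.

fibVal-< : ∀ w → NoConsecutiveOnes w → fibVal w < fib (2 + length w)
fibVal-< []                 _  = s≤s z≤n
fibVal-< (false ∷ w)        nc = <-≤-trans (fibVal-< w nc) (m≤m+n _ _)
fibVal-< (true ∷ [])        _  = ≤-refl
fibVal-< (true ∷ false ∷ w) nc = +-monoʳ-< (fib (3 + length w)) (fibVal-< w nc)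

-- With l = `length w`, a leading 10 adds F_{l+3} to a value below F_{l+2}, which is where
-- `ftm-fib+` flips the letter.
bitParity≡ftm : ∀ w → NoConsecutiveOnes w → bitParity w ≡ ftm (fibVal w)
bitParity≡ftm []                 _  = refl
bitParity≡ftm (false ∷ w)        nc = bitParity≡ftm w nc
bitParity≡ftm (true ∷ [])        _  = refl
bitParity≡ftm (true ∷ false ∷ w) nc =
  trans (cong not (bitParity≡ftm w nc)) (sym (ftm-fib+ (2 + length w) (fibVal-< w nc)))

-- Greedy expansion, padded with zeros to length `k`: after a one is placed, the remainder is small
-- enough for a zero to follow. `stripZeros` then removes the padding.
fibWord : ∀ k n → n < fib (2 + k) →
          ∃ λ w → length w ≡ k × NoConsecutiveOnes w × n ≡ fibVal w
fibWord zero n n< = [] , refl , tt , n<1⇒n≡0 n<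
fibWord (suc k) n n< with n <? fib (2 + k)
... | yes n<′ with w , refl , nc , eq ← fibWord k n n<′ = false ∷ w , refl , nc , eq
fibWord (suc zero) n n< | no n≮ = true ∷ [] , refl , tt , ≤-antisym (≤-pred n<) (≮⇒≥ n≮)
fibWord (suc (suc k)) n n< | no n≮
  with w , refl , nc , eq ← fibWord k (n ∸ fib (3 + k))
         (+-cancelˡ-< (fib (3 + k)) _ _ (subst (_< fib (4 + k)) (sym (m+[n∸m]≡n (≮⇒≥ n≮))) n<))
  = true ∷ false ∷ w , refl , nc ,
    trans (sym (m+[n∸m]≡n (≮⇒≥ n≮))) (cong (fib (3 + k) +_) eq)

stripZeros : ∀ {n} w → NoConsecutiveOnes w → n ≡ fibVal w → ∃ (IsFibRep n)
stripZeros []          nc eq = [] , tt , nc , eq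
stripZeros (false ∷ w) nc eq = stripZeros w nc eq
stripZeros (true ∷ w)  nc eq = true ∷ w , refl , nc , eq

Ftm-ftm : ∀ n → Ftm n (ftm n)
Ftm-ftm n
  with w , _ , nc , eq ← fibWord n n (n<fib[2+n] n)
  with v , rep@(_ , nc′ , eq′) ← stripZeros w nc eq
  = v , rep , trans (bitParity≡ftm v nc′) (cong ftm (sym eq′))

Ftm⇒ftm : ∀ {n b} → Ftm n b → b ≡ ftm n
Ftm⇒ftm (w , (_ , nc , refl) , refl) = bitParity≡ftm w nc

-- Windows of ftm agreeing up to complement

-- The flag `b` is `true` for complementary windows, so flags compose by `xor`. A record keeps the
-- parameters inferable.
record Match (b : Bool) (n i j : ℕ) : Set where
  constructor match
  field at : ∀ {t} → t < n → ftm (i + t) ≡ b xor ftm (j + t)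

open Match

match-trans : ∀ {b c n i j k} → Match b n i j → Match c n j k → Match (b xor c) n i k
match-trans {b} {c} p q .at t< = trans (at p t<) (trans (cong (b xor_) (at q t<)) (sym (xor-assoc b c _)))

match-sym : ∀ {b n i j} → Match b n i j → Match b n j i
match-sym {false} p .at t< = sym (at p t<)
match-sym {true}  p .at t< = sym (trans (cong not (at p t<)) (not-involutive _))

match-≤ : ∀ {b m n i j} → m ≤ n → Match b n i j → Match b m i j
match-≤ m≤n p .at t< = at p (<-≤-trans t< m≤n)

match-++ : ∀ {b} s {m i j} → Match b s i j → Match b m (i + s) (j + s) → Match b (s + m) i j
match-++ {b} s {m} {i} {j} p q .at {t} t< with t <? s
... | yes t<s = at p t<s
... | no t≮s = subst (λ u → ftm (i + u) ≡ b xor ftm (j + u)) s+u≡t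
    (subst₂ (λ x y → ftm x ≡ b xor ftm y) (+-assoc i s u) (+-assoc j s u)
      (at q (+-cancelˡ-< s _ _ (subst (_< s + m) (sym s+u≡t) t<))))
  where
  u = t ∸ s
  s+u≡t : s + u ≡ t
  s+u≡t = m+[n∸m]≡n (≮⇒≥ t≮s)

match-cast : ∀ {b n i j i′ j′} → i ≡ i′ → j ≡ j′ → Match b n i j → Match b n i′ j′
match-cast refl refl p = p

match-fib+ : ∀ j {n} q → n + q ≤ fib j → Match true n (fib (suc j) + q) q
match-fib+ j {n} q n+q≤ .at {t} t< =
  trans (cong ftm (+-assoc (fib (suc j)) q t))
        (ftm-fib+ j (<-≤-trans (subst (_< n + q) (+-comm t q) (+-monoˡ-< q t<)) n+q≤))

match-fib : ∀ j {n} → n ≤ fib j → Match true n (fib (suc j)) 0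
match-fib j {n} n≤ =
  match-cast (+-identityʳ _) refl (match-fib+ j 0 (subst (_≤ fib j) (sym (+-identityʳ n)) n≤))

-- After both F_{a+1} and F_{b+1} stands the complement of a prefix of `ftm`, so only the `s`
-- letters before these points have to be compared.
match-cross : ∀ a b {s m i j} → i + s ≡ fib (suc a) → j + s ≡ fib (suc b) → m ≤ fib a → m ≤ fib b →
              Match false s i j → Match false (s + m) i j
match-cross a b {s} i+s j+s m≤a m≤b p =
  match-++ s p (match-cast (sym i+s) (sym j+s) (match-trans (match-fib a m≤a) (match-sym (match-fib b m≤b))))

-- The words ending at F_{j+5} and at F_{j+1} agree, since X_{j+5} ends with X_{j+1}.
match-fib⁴ : ∀ j {s m} q → q + s ≡ fib (suc j) → m ≤ fib j →
             Match false (s + m) (fib (4 + j) + (fib (2 + j) + q)) q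
match-fib⁴ j {s} {m} q q+s m≤ =
  match-cross (4 + j) j eq q+s (≤-trans m≤ (fib-≤-+ 4 j)) m≤
    (match-trans (match-fib+ (3 + j) (fib (2 + j) + q) (≤-reflexive eq₁))
                 (match-fib+ (suc j) q (≤-reflexive (trans (+-comm s q) q+s))))
  where
  eq₁ : s + (fib (2 + j) + q) ≡ fib (3 + j)
  eq₁ = trans (+-comm s _) (trans (+-assoc _ q s) (cong (fib (2 + j) +_) q+s))
  eq : fib (4 + j) + (fib (2 + j) + q) + s ≡ fib (5 + j)
  eq = trans (+-assoc (fib (4 + j)) _ s) (cong (fib (4 + j) +_) (trans (+-comm _ s) eq₁))

-- X_{h+2} ~X_{h+1} X_h can be cut both after X_{h+2} and after X_{h+3} = X_{h+2} ~X_{h+1}.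
match-overlap : ∀ h {s m} q → q + s ≡ fib (2 + h) → m ≤ fib h →
                Match true (s + fib (suc h) + m) (fib (4 + h) + q) (fib (5 + h) + (fib (3 + h) + q))
match-overlap h {s} {m} q q+s m≤ =
  match-++ (s + fib (suc h))
    (match-trans (match-fib+ (3 + h) q (≤-reflexive eq₁)) (match-sym (match-fib⁴ (suc h) q q+s ≤-refl)))
    -- The first window has reached F_{h+5}, where ~P stands. The second is F_{h+1} places past
    -- F_{h+6}, where two complementations give P.
    (match-cast (sym eq₂) (sym eq₃)
      (match-trans (match-fib (4 + h) (≤-trans m≤ (fib-≤-+ 4 h)))
        (match-sym (match-trans
          (match-fib+ (5 + h) (fib (suc h))
            (≤-trans (+-monoˡ-≤ (fib (suc h)) m≤)
              (≤-trans (≤-reflexive (+-comm (fib h) (fib (suc h)))) (fib-≤-+ 3 (2 + h)))))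
          (match-fib h m≤)))))
  where
  eq₀ : q + (s + fib (suc h)) ≡ fib (3 + h)
  eq₀ = trans (sym (+-assoc q s _)) (cong (_+ fib (suc h)) q+s)
  eq₁ : s + fib (suc h) + q ≡ fib (3 + h)
  eq₁ = trans (+-comm _ q) eq₀
  eq₂ : fib (4 + h) + q + (s + fib (suc h)) ≡ fib (5 + h)
  eq₂ = trans (+-assoc (fib (4 + h)) q _) (cong (fib (4 + h) +_) eq₀)
  eq₃ : fib (5 + h) + (fib (3 + h) + q) + (s + fib (suc h)) ≡ fib (6 + h) + fib (suc h)
  eq₃ = begin
    fib (5 + h) + (fib (3 + h) + q) + (s + fib (suc h)) ≡⟨ +-assoc (fib (5 + h)) _ _ ⟩
    fib (5 + h) + (fib (3 + h) + q + (s + fib (suc h))) ≡⟨ cong (fib (5 + h) +_) (+-assoc (fib (3 + h)) q _) ⟩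
    fib (5 + h) + (fib (3 + h) + (q + (s + fib (suc h)))) ≡⟨ cong (λ x → fib (5 + h) + (fib (3 + h) + x)) eq₀ ⟩
    fib (5 + h) + (fib (3 + h) + (fib (2 + h) + fib (suc h))) ≡⟨ cong (fib (5 + h) +_) (sym (+-assoc (fib (3 + h)) _ _)) ⟩
    fib (5 + h) + (fib (4 + h) + fib (suc h)) ≡⟨ sym (+-assoc (fib (5 + h)) _ _) ⟩
    fib (6 + h) + fib (suc h) ∎
    where open ≡-Reasoning

-- Covering all windows of length F_K + 1

lastLetter : ℕ → Bool
lastLetter j = ftm (fib j ∸ 1)

lastLetter-2+ : ∀ j → lastLetter (3 + j) ≡ not (lastLetter (suc j))
lastLetter-2+ j =
  trans (cong ftm (+-∸-assoc (fib (2 + j)) (fib-pos j)))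
        (ftm-fib+ (suc j) (∸-monoʳ-< (s≤s z≤n) (fib-pos j)))

match-last : ∀ a b {m i j} → i + 1 ≡ fib (suc a) → j + 1 ≡ fib (suc b) → m ≤ fib a → m ≤ fib b →
             lastLetter (suc a) ≡ lastLetter (suc b) → Match false (suc m) i j
match-last a b {i = i} {j} i+1 j+1 m≤a m≤b same = match-cross a b i+1 j+1 m≤a m≤b one
  where
  pred-eq : ∀ {l} c → l + 1 ≡ fib (suc c) → l + 0 ≡ fib (suc c) ∸ 1
  pred-eq {l} c l+1 = trans (+-identityʳ l) (trans (sym (m+n∸n≡m l 1)) (cong (_∸ 1) l+1))
  one : Match false 1 i j
  one .at {zero}  _ = trans (cong ftm (pred-eq a i+1)) (trans same (cong ftm (sym (pred-eq b j+1))))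
  one .at {suc t} (s≤s ())

descending : ℕ → ℕ → ℕ → List ℕ
descending F c n = applyUpTo (λ u → F ∸ (c + u)) n

length-descending : ∀ F c n → length (descending F c n) ≡ n
length-descending F c n = length-applyUpTo (λ u → F ∸ (c + u)) n

-- Starting points F_J − s, where J runs from K+1 to K+4 and K = k + 3; the ranges of s avoid repetitions.
starts₁ starts₂ starts₃ starts₄ starts : ℕ → List ℕ
starts₁ k = descending (fib (4 + k)) 2 (fib (3 + k) ∸ 1)
starts₂ k = descending (fib (5 + k)) 1 (fib (suc k) + fib (suc k))
starts₃ k = descending (fib (6 + k)) 2 (fib (2 + k) ∸ 1)
starts₄ k = descending (fib (7 + k)) 1 (fib (3 + k))
starts k = starts₁ k ++ starts₂ k ++ starts₃ k ++ starts₄ k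

Covered : ℕ → ℕ → Set
Covered k i = ∃₂ λ b j → j ∈ starts k × Match b (suc (fib (3 + k))) i j

covered-via : ∀ k {b i j} → Match b (suc (fib (3 + k))) i j → Covered k j → Covered k i
covered-via k p (c , l , l∈ , q) = _ , l , l∈ , match-trans p q

∈-descending : ∀ {F n} c {i s} → i + s ≡ F → c ≤ s → s < c + n → i ∈ descending F c n
∈-descending {F} {n} c {i} {s} refl c≤s s< =
  subst (_∈ descending F c n)
    (trans (cong (i + s ∸_) (m+[n∸m]≡n c≤s)) (m+n∸n≡m i s))
    (∈-applyUpTo⁺ (λ u → F ∸ (c + u)) (+-cancelˡ-< c _ _ (subst (_< c + n) (sym (m+[n∸m]≡n c≤s)) s<)))

module _ (k : ℕ) where

  in-starts : ∀ {i} → i ∈ starts k → Covered k i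
  in-starts i∈ = false , _ , i∈ , match (λ _ → refl)

  <2+[fib∸1] : ∀ j {s} → s ≤ fib (suc j) → s < 2 + (fib (suc j) ∸ 1)
  <2+[fib∸1] j s≤ = s≤s (subst (_ ≤_) (sym (m+[n∸m]≡n (fib-pos j))) s≤)

  start₁ : ∀ {i s} → i + s ≡ fib (4 + k) → 2 ≤ s → s ≤ fib (3 + k) → Covered k i
  start₁ i+s 2≤s s≤ = in-starts (∈-++⁺ˡ (∈-descending 2 i+s 2≤s (<2+[fib∸1] (2 + k) s≤)))

  start₂ : ∀ {i s} → i + s ≡ fib (5 + k) → 1 ≤ s → s ≤ fib (suc k) + fib (suc k) → Covered k i
  start₂ i+s 1≤s s≤ = in-starts (∈-++⁺ʳ (starts₁ k) (∈-++⁺ˡ (∈-descending 1 i+s 1≤s (s≤s s≤))))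

  start₃ : ∀ {i s} → i + s ≡ fib (6 + k) → 2 ≤ s → s ≤ fib (2 + k) → Covered k i
  start₃ i+s 2≤s s≤ =
    in-starts (∈-++⁺ʳ (starts₁ k) (∈-++⁺ʳ (starts₂ k) (∈-++⁺ˡ (∈-descending 2 i+s 2≤s (<2+[fib∸1] (suc k) s≤)))))

  start₄ : ∀ {i s} → i + s ≡ fib (7 + k) → 1 ≤ s → s ≤ fib (3 + k) → Covered k i
  start₄ i+s 1≤s s≤ =
    in-starts (∈-++⁺ʳ (starts₁ k) (∈-++⁺ʳ (starts₂ k) (∈-++⁺ʳ (starts₃ k) (∈-descending 1 i+s 1≤s (s≤s s≤)))))

  private
    ∸1 : ∀ j → fib (suc j) ∸ 1 + 1 ≡ fib (suc j)
    ∸1 j = m∸n+n≡m (fib-pos j)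

  -- Last letters flip when the index grows by 2, so K+1 and K+3 are paired with K+2 and K+4 in one
  -- of two ways. Hence the windows with s = 1 at F_{K+1} and F_{K+3} are repetitions, and `starts₁`
  -- and `starts₃` begin at s = 2.
  lastLetter-pairs : lastLetter (4 + k) ≡ lastLetter (5 + k) × lastLetter (6 + k) ≡ lastLetter (7 + k)
         ⊎ lastLetter (4 + k) ≡ lastLetter (7 + k) × lastLetter (6 + k) ≡ lastLetter (5 + k)
  lastLetter-pairs with lastLetter (4 + k) ≟ᵇ lastLetter (5 + k)
  ... | yes eq = inj₁ (eq , trans (lastLetter-2+ (3 + k)) (trans (cong not eq) (sym (lastLetter-2+ (4 + k)))))
  ... | no neq = inj₂ ( trans (¬-not neq) (sym (lastLetter-2+ (4 + k)))
                      , trans (lastLetter-2+ (3 + k)) (sym (¬-not (λ e → neq (sym e)))) )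

  private
    2≤⊎≡1 : ∀ {s} → 1 ≤ s → 2 ≤ s ⊎ s ≡ 1
    2≤⊎≡1 {suc zero}    _ = inj₂ refl
    2≤⊎≡1 {suc (suc _)} _ = inj₁ (s≤s (s≤s z≤n))

    single₂ : Covered k (fib (5 + k) ∸ 1)
    single₂ = start₂ (∸1 (4 + k)) ≤-refl (≤-trans (fib-pos k) (m≤m+n _ _))

    single₄ : Covered k (fib (7 + k) ∸ 1)
    single₄ = start₄ (∸1 (6 + k)) ≤-refl (fib-pos (2 + k))

  crossing₁ : ∀ {i s} → i + s ≡ fib (4 + k) → 1 ≤ s → s ≤ fib (3 + k) → Covered k i
  crossing₁ i+s 1≤s s≤ with 2≤⊎≡1 1≤s
  ... | inj₁ 2≤s = start₁ i+s 2≤s s≤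
  ... | inj₂ refl with lastLetter-pairs
  ...   | inj₁ (eq , _) =
    covered-via k (match-last (3 + k) (4 + k) i+s (∸1 (4 + k)) ≤-refl (fib-≤-+ 1 (3 + k)) eq) single₂
  ...   | inj₂ (eq , _) =
    covered-via k (match-last (3 + k) (6 + k) i+s (∸1 (6 + k)) ≤-refl (fib-≤-+ 3 (3 + k)) eq) single₄

  crossing₃ : ∀ {i s} → i + s ≡ fib (6 + k) → 1 ≤ s → s ≤ fib (2 + k) → Covered k i
  crossing₃ i+s 1≤s s≤ with 2≤⊎≡1 1≤s
  ... | inj₁ 2≤s = start₃ i+s 2≤s s≤
  ... | inj₂ refl with lastLetter-pairs
  ...   | inj₁ (_ , eq) =
    covered-via k (match-last (5 + k) (6 + k) i+s (∸1 (6 + k)) (fib-≤-+ 2 (3 + k)) (fib-≤-+ 3 (3 + k)) eq) single₄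
  ...   | inj₂ (_ , eq) =
    covered-via k (match-last (5 + k) (4 + k) i+s (∸1 (4 + k)) (fib-≤-+ 2 (3 + k)) (fib-≤-+ 1 (3 + k)) eq) single₂

  -- By `match-overlap` a window crossing F_{h+5} can be moved to F_{h+6}, with F_{h+1} fewer
  -- letters before the cut. The bound on `s + fib h` says that at most F_h letters of the window
  -- lie after F_{h+5}.
  redundant : ∀ h {i s} → i + s ≡ fib (5 + h) → fib (suc h) < s → s ≤ fib (3 + h) → fib (3 + k) < s + fib h →
            (∀ {j s′} → s ≡ s′ + fib (suc h) → j + s′ ≡ fib (6 + h) → Covered k j) →
            s ≤ fib (3 + k) → Covered k i
  redundant h {i} {s} i+s <s s≤ short cov s≤K = covered-via k m (cov (sym s′+) j+s′)
    where
    s′ = s ∸ fib (suc h)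
    q  = fib (3 + h) ∸ s
    s′+ : s′ + fib (suc h) ≡ s
    s′+ = m∸n+n≡m (<⇒≤ <s)
    q+s : q + s ≡ fib (3 + h)
    q+s = m∸n+n≡m s≤
    q+s′ : q + s′ ≡ fib (2 + h)
    q+s′ = +-cancelʳ-≡ (fib (suc h)) _ _ (trans (+-assoc q s′ _) (trans (cong (q +_) s′+) q+s))
    i≡ : fib (4 + h) + q ≡ i
    i≡ = +-cancelʳ-≡ s _ _ (trans (+-assoc (fib (4 + h)) q s) (trans (cong (fib (4 + h) +_) q+s) (sym i+s)))
    j+s′ : fib (5 + h) + (fib (3 + h) + q) + s′ ≡ fib (6 + h)
    j+s′ = trans (+-assoc (fib (5 + h)) _ s′)
             (cong (fib (5 + h) +_) (trans (+-assoc (fib (3 + h)) q s′) (cong (fib (3 + h) +_) q+s′)))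
    m = match-≤ (≤-reflexive (sym (trans (cong (_+ (suc (fib (3 + k)) ∸ s)) s′+) (m+[n∸m]≡n (m≤n⇒m≤1+n s≤K)))))
          (match-cast i≡ refl
            (match-overlap h q q+s′ (m≤n+o⇒m∸n≤o (suc (fib (3 + k))) s short)))

  -- Here J = K+1+e. Four consecutive values of J suffice, because `match-fib⁴` moves a crossing of
  -- F_J to F_{J-4}.
  crossing : ∀ e {i s} → i + s ≡ fib (4 + (e + k)) → 1 ≤ s → s ≤ fib (3 + k) → Covered k i
  crossing 0 i+s 1≤s s≤ = crossing₁ i+s 1≤s s≤
  crossing 1 {i} {s} i+s 1≤s s≤ with s ≤? fib (suc k) + fib (suc k)
  ... | yes small = start₂ i+s 1≤s small
  -- The range of `starts₂` stops at 2 F_{K-2} because 2 F_{K-2} + F_{K-3} = F_K: beyond it, at most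
  -- F_{K-3} letters follow the cut.
  ... | no ¬small = redundant k i+s (≤-<-trans (m≤m+n _ _) big) s≤
          (subst (_< s + fib k)
            (trans (+-assoc (fib (suc k)) (fib (suc k)) (fib k)) (+-comm (fib (suc k)) _))
            (+-monoˡ-< (fib k) big))
          (λ { {j} {s′} refl j+s′ → crossing₃ j+s′
                 (≤-trans (fib-pos k) (+-cancelʳ-≤ (fib (suc k)) _ _ (<⇒≤ big)))
                 (+-cancelʳ-≤ (fib (suc k)) _ _ s≤) })
          s≤
    where
    big : fib (suc k) + fib (suc k) < s
    big = ≰⇒> ¬small
  crossing 2 {i} {s} i+s 1≤s s≤ with s ≤? fib (2 + k)
  ... | yes small = crossing₃ i+s 1≤s small
  ... | no ¬small = redundant (suc k) i+s big (≤-trans s≤ (fib-≤-suc (3 + k))) (+-monoˡ-< (fib (suc k)) big)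
          (λ { {j} {s′} refl j+s′ → start₄ j+s′ (+-cancelʳ-≤ (fib (2 + k)) 1 s′ big)
                 (≤-trans (m≤m+n s′ _) s≤) })
          s≤
    where
    big : fib (2 + k) < s
    big = ≰⇒> ¬small
  crossing 3 i+s 1≤s s≤ = start₄ i+s 1≤s s≤
  crossing (suc (suc (suc (suc e)))) {i} {s} i+s 1≤s s≤ =
    covered-via k
      (match-≤ (≤-reflexive (sym (m+[n∸m]≡n (m≤n⇒m≤1+n s≤))))
        (match-cast i≡ refl
          (match-fib⁴ (3 + (e + k)) q q+s
            (≤-trans (m≤n+o⇒m∸n≤o (suc (fib (3 + k))) s (+-monoˡ-≤ (fib (3 + k)) 1≤s))
                     (fib-mono {3 + k} (+-monoʳ-≤ 3 (m≤n+m k e)))))))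
      (crossing e q+s 1≤s s≤)
    where
    q = fib (4 + (e + k)) ∸ s
    q+s : q + s ≡ fib (4 + (e + k))
    q+s = m∸n+n≡m (≤-trans s≤ (fib-mono {3 + k} (+-monoʳ-≤ 3 (m≤n⇒m≤1+n (m≤n+m k e)))))
    i≡ : fib (7 + (e + k)) + (fib (5 + (e + k)) + q) ≡ i
    i≡ = +-cancelʳ-≡ s _ _
      (trans (+-assoc (fib (7 + (e + k))) _ s)
      (trans (cong (fib (7 + (e + k)) +_) (trans (+-assoc (fib (5 + (e + k))) q s) (cong (fib (5 + (e + k)) +_) q+s)))
             (sym i+s)))

  -- Induction along X_{J+1} = X_J ~X_{J-1}: a window inside ~X_{J-1} is the complement of an
  -- earlier one, and any other window that starts there crosses F_{J+1}.
  covered-below : ∀ e {i} → i < fib (4 + (e + k)) → Covered k i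
  covered-below zero {i} i< with i <? fib (2 + k)
  -- X_{K+4} ends with X_K, and at most F_{K-1} letters of this window lie past F_K, so it reappears
  -- across F_{K+4}.
  ... | yes i<′ =
    covered-via k
      (match-≤ (≤-reflexive (sym (trans (+-suc s i) (cong suc (trans (+-comm s i) i+s)))))
        (match-sym (match-fib⁴ (2 + k) i i+s i<′)))
      (start₄ (trans (+-assoc (fib (6 + k)) _ s)
                (cong (fib (6 + k) +_) (trans (+-assoc (fib (4 + k)) i s) (cong (fib (4 + k) +_) i+s))))
              (m<n⇒0<n∸m i<K) (m∸n≤m (fib (3 + k)) i))
    where
    i<K : i < fib (3 + k)
    i<K = <-≤-trans i<′ (fib-≤-suc (2 + k))
    s = fib (3 + k) ∸ i
    i+s : i + s ≡ fib (3 + k)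
    i+s = m+[n∸m]≡n (<⇒≤ i<K)
  ... | no i≮ = crossing 0 {s = fib (4 + k) ∸ i} (m+[n∸m]≡n (<⇒≤ i<)) (m<n⇒0<n∸m i<)
      (m≤n+o⇒m∸n≤o (fib (4 + k)) i
        (subst (_≤ i + fib (3 + k)) (+-comm (fib (2 + k)) _) (+-monoˡ-≤ (fib (3 + k)) (≮⇒≥ i≮))))
  covered-below (suc e) {i} i< with i <? fib (4 + (e + k))
  ... | yes i<′ = covered-below e i<′
  ... | no i≮ = go
    where
    r = i ∸ fib (4 + (e + k))
    r+ : fib (4 + (e + k)) + r ≡ i
    r+ = m+[n∸m]≡n (≮⇒≥ i≮)
    r< : r < fib (3 + (e + k))
    r< = +-cancelˡ-< (fib (4 + (e + k))) _ _ (subst (_< fib (5 + (e + k))) (sym r+) i<)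
    go : Covered k i
    go with suc (fib (3 + k)) + r ≤? fib (3 + (e + k))
    ... | yes fits = covered-via k (match-cast r+ refl (match-fib+ (3 + (e + k)) r fits))
                       (covered-below e (<-≤-trans r< (fib-≤-suc (3 + (e + k)))))
    ... | no ¬fits = crossing (suc e) {s = fib (3 + (e + k)) ∸ r}
                       (trans (cong (_+ (fib (3 + (e + k)) ∸ r)) (sym r+))
                         (trans (+-assoc (fib (4 + (e + k))) r _) (cong (fib (4 + (e + k)) +_) (m+[n∸m]≡n (<⇒≤ r<)))))
                       (m<n⇒0<n∸m r<)
                       (m≤n+o⇒m∸n≤o (fib (3 + (e + k))) r
                         (subst (fib (3 + (e + k)) ≤_) (+-comm (fib (3 + k)) r) (≤-pred (≰⇒> ¬fits))))

  covered : ∀ i → Covered k i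
  covered i = covered-below i (<-≤-trans (n<fib[2+n] i) (fib-mono (+-mono-≤ {2} {4} (s≤s (s≤s z≤n)) (m≤m+n i k))))

-- The `2 +` makes up for the two `∸ 1` in the ranges. Doubled, to count complements, the length is
-- 8 F_K - 2 F_{K-1} - 4.
length-starts : ∀ k → 2 + length (starts k) ≡ 2 * fib (3 + k) + 2 * fib (suc k) + fib (2 + k)
length-starts k
  rewrite length-++ (starts₁ k) {starts₂ k ++ starts₃ k ++ starts₄ k}
        | length-++ (starts₂ k) {starts₃ k ++ starts₄ k}
        | length-++ (starts₃ k) {starts₄ k}
        | length-descending (fib (4 + k)) 2 (fib (3 + k) ∸ 1)
        | length-descending (fib (5 + k)) 1 (fib (suc k) + fib (suc k))
        | length-descending (fib (6 + k)) 2 (fib (2 + k) ∸ 1)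
        | length-descending (fib (7 + k)) 1 (fib (3 + k))
  = count {c = fib (suc k)} (fib-pos (2 + k)) (fib-pos (suc k))
  where
  count : ∀ {a b c} → 1 ≤ a → 1 ≤ b → 2 + (a ∸ 1 + (c + c + (b ∸ 1 + a))) ≡ 2 * a + 2 * c + b
  count {suc a} {suc b} {c} _ _ = solve 3 (λ a b c →
    con 2 :+ (a :+ (c :+ c :+ (b :+ (con 1 :+ a))))
    := con 2 :* (con 1 :+ a) :+ con 2 :* c :+ (con 1 :+ b)) refl a b c
    where open +-*-Solver

-- Factors as windows

-- The sequence is a parameter, to serve `ftm`, its complement and the faster `ftmBelow`.
window : (ℕ → Bool) → ∀ n → ℕ → Vec Bool n
window f zero    i = []
window f (suc n) i = f i ∷ window f n (suc i)

lookup-window : ∀ f {n} i j → lookup (window f n i) j ≡ f (i + toℕ j)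
lookup-window f i zero    = cong f (sym (+-identityʳ i))
lookup-window f i (suc j) = trans (lookup-window f (suc i) j) (cong f (sym (+-suc i (toℕ j))))

window-cong : ∀ {f g} n {i j} → (∀ {t} → t < n → f (i + t) ≡ g (j + t)) → window f n i ≡ window g n j
window-cong zero eq = refl
window-cong {f} {g} (suc n) {i} {j} eq = cong₂ _∷_
  (trans (cong f (sym (+-identityʳ i))) (trans (eq (s≤s z≤n)) (cong g (+-identityʳ j))))
  (window-cong n λ {t} t< → trans (cong f (sym (+-suc i t))) (trans (eq (s≤s t<)) (cong g (+-suc j t))))

window-injective : ∀ {f g} n {i j} → window f n i ≡ window g n j → ∀ {t} → t < n → f (i + t) ≡ g (j + t)
window-injective {f} {g} (suc n) {i} {j} eq {zero} _ =
  trans (cong f (+-identityʳ i)) (trans (∷-injectiveˡ eq) (cong g (sym (+-identityʳ j))))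
window-injective {f} {g} (suc n) {i} {j} eq {suc t} (s≤s t<) =
  trans (cong f (+-suc i t)) (trans (window-injective n (∷-injectiveʳ eq) t<) (cong g (sym (+-suc j t))))

word : Bool → ∀ n → ℕ → Vec Bool n
word b = window (λ t → b xor ftm t)

match⇒word : ∀ {b} c {n i j} → Match b n i j → word c n i ≡ word (c xor b) n j
match⇒word {b} c {n} p = window-cong n λ t< → trans (cong (c xor_) (at p t<)) (sym (xor-assoc c b _))

Factor : ∀ {n} → Vec Bool n → Set
Factor {n} x = ∃ λ i → x ≡ word false n i

IsFactor⇒Factor : ∀ {n} {x : Vec Bool n} → IsFactor x → Factor x
IsFactor⇒Factor {n} {x} (i , occ) = i , (begin
  x                                     ≡⟨ tabulate∘lookup x ⟨
  tabulate (lookup x)                   ≡⟨ tabulate-cong (λ j → trans (Ftm⇒ftm (occ j)) (sym (lookup-window _ i j))) ⟩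
  tabulate (lookup (word false n i))    ≡⟨ tabulate∘lookup (word false n i) ⟩
  word false n i                        ∎)
  where open ≡-Reasoning

Factor⇒IsFactor : ∀ {n} {x : Vec Bool n} → Factor x → IsFactor x
Factor⇒IsFactor (i , refl) = i , λ j → subst (Ftm _) (sym (lookup-window _ i j)) (Ftm-ftm (i + toℕ j))

-- The window lies inside X_{n+i+2}, whose complement follows X_{n+i+3}. So the set of factors is
-- closed under complement.
match-complement : ∀ n i → Match true n (fib (3 + (n + i)) + i) i
match-complement n i = match-fib+ (2 + (n + i)) i (<⇒≤ (n<fib[2+n] (n + i)))

factor-word : ∀ b n i → Factor (word b n i)
factor-word false n i = i , refl
factor-word true  n i = fib (3 + (n + i)) + i , sym (match⇒word false (match-complement n i))

factor-tail : ∀ {n c} {x : Vec Bool n} → Factor (c ∷ x) → Factor x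
factor-tail (i , eq) = suc i , ∷-injectiveʳ eq

-- An occurrence at position 0 has no letter before it, so the letter is read before a complemented
-- copy further right and complemented back.
factor-extend : ∀ {n} {x : Vec Bool n} → Factor x → ∃ λ c → Factor (c ∷ x)
factor-extend {n} (i , refl) = not (ftm j) , subst (λ x → Factor (not (ftm j) ∷ x)) eq (factor-word true (suc n) j)
  where
  j = fib (3 + (n + i)) ∸ 1 + i
  eq : word true n (suc j) ≡ word false n i
  eq = match⇒word true (match-cast (cong (_+ i) (sym (m+[n∸m]≡n (fib-pos (2 + (n + i)))))) refl (match-complement n i))

-- Counting factors

_≟ᵥ_ : ∀ {n} → DecidableEquality (Vec Bool n)
_≟ᵥ_ = ≡-dec _≟ᵇ_

module _ {a} {A : Set a} where

  length-⊆ : ∀ {xs ys : List A} → Unique xs → (∀ {x} → x ∈ xs → x ∈ ys) → length xs ≤ length ys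
  length-⊆ {[]} _ _ = z≤n
  length-⊆ {x ∷ xs} (x∉ ∷ uniq) sub with as , bs , refl ← ∈-∃++ (sub (here refl)) = begin
    suc (length xs)             ≤⟨ s≤s (length-⊆ uniq sub′) ⟩
    suc (length (as ++ bs))     ≡⟨ cong suc (length-++ as) ⟩
    suc (length as + length bs) ≡⟨ +-suc (length as) (length bs) ⟨
    length as + suc (length bs) ≡⟨ length-++ as ⟨
    length (as ++ x ∷ bs)       ∎
    where
    open ≤-Reasoning
    sub′ : ∀ {y} → y ∈ xs → y ∈ as ++ bs
    sub′ y∈ with ∈-++⁻ as (sub (there y∈))
    ... | inj₁ ∈as         = ∈-++⁺ˡ ∈as
    ... | inj₂ (here refl) = ⊥-elim (All.lookup x∉ y∈ refl)
    ... | inj₂ (there ∈bs) = ∈-++⁺ʳ as ∈bs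

candidates : ℕ → ∀ n → List (Vec Bool n)
candidates k n = map (word false n) (starts k) ++ map (word true n) (starts k)

candidate-factor : ∀ k {n} {x : Vec Bool n} → x ∈ candidates k n → Factor x
candidate-factor k {n} x∈ with ∈-++⁻ (map (word false n) (starts k)) x∈
... | inj₁ x∈₁ with i , _ , refl ← ∈-map⁻ (word false n) x∈₁ = factor-word false n i
... | inj₂ x∈₂ with i , _ , refl ← ∈-map⁻ (word true n) x∈₂ = factor-word true n i

factor-candidate : ∀ k {n} {x : Vec Bool n} → n ≤ suc (fib (3 + k)) → Factor x → x ∈ candidates k n
factor-candidate k {n} n≤ (i , refl) with covered k i
... | false , j , j∈ , p = subst (_∈ candidates k n) (sym (match⇒word false (match-≤ n≤ p)))
                             (∈-++⁺ˡ (∈-map⁺ (word false n) j∈))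
... | true  , j , j∈ , p = subst (_∈ candidates k n) (sym (match⇒word false (match-≤ n≤ p)))
                             (∈-++⁺ʳ (map (word false n) (starts k)) (∈-map⁺ (word true n) j∈))

-- The index `k = n` is a uniform choice that satisfies n ≤ F_{k+3} + 1, as `factor-candidate`
-- requires.
factors : ∀ n → List (Vec Bool n)
factors n = deduplicate _≟ᵥ_ (candidates n n)

factors-unique : ∀ n → Unique (factors n)
factors-unique n = deduplicate-! _≟ᵥ_ (candidates n n)

∈-factors⁻ : ∀ {n} {x : Vec Bool n} → x ∈ factors n → Factor x
∈-factors⁻ {n} = candidate-factor n ∘ ∈-deduplicate⁻ _≟ᵥ_ (candidates n n)

∈-factors⁺ : ∀ {n} {x : Vec Bool n} → Factor x → x ∈ factors n
∈-factors⁺ {n} = ∈-deduplicate⁺ _≟ᵥ_ ∘ factor-candidate n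
  (m≤n⇒m≤1+n (≤-trans (<⇒≤ (n<fib[2+n] n)) (fib-≤-suc (2 + n))))

-- Abstract, so that comparing ρ m with ρ n never unfolds the enumeration.
abstract
  ρ : ℕ → ℕ
  ρ n = length (factors n)

  ρ≡length : ∀ n → ρ n ≡ length (factors n)
  ρ≡length n = refl

factorCount : ∀ n → FactorCount n (ρ n)
factorCount n = factors n , factors-unique n , sym (ρ≡length n) ,
  λ x → mk⇔ (Factor⇒IsFactor ∘ ∈-factors⁻) (∈-factors⁺ ∘ IsFactor⇒Factor)

diffEq : ∀ n {c} → ρ (suc n) ≡ ρ n + c → DiffEq n c
diffEq n eq = ρ n , factorCount n , subst (FactorCount (suc n)) eq (factorCount (suc n))

ρ-lower : ∀ {n} (xs : List (Vec Bool n)) → Unique xs → (∀ {x} → x ∈ xs → Factor x) → length xs ≤ ρ n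
ρ-lower {n} xs uniq fac = subst (length xs ≤_) (sym (ρ≡length n)) (length-⊆ uniq (∈-factors⁺ ∘ fac))

ρ-upper : ∀ k → ρ (suc (fib (3 + k))) ≤ 2 * length (starts k)
ρ-upper k = begin
  ρ N                                               ≡⟨ ρ≡length N ⟩
  length (factors N)                                ≤⟨ length-⊆ (factors-unique N) (factor-candidate k ≤-refl ∘ ∈-factors⁻) ⟩
  length (candidates k N)                           ≡⟨ length-++ (map (word false N) (starts k)) ⟩
  length (map (word false N) (starts k)) + length (map (word true N) (starts k))
    ≡⟨ cong₂ _+_ (length-map (word false N) (starts k)) (length-map (word true N) (starts k)) ⟩
  length (starts k) + length (starts k)             ≡⟨ cong (length (starts k) +_) (+-identityʳ _) ⟨
  2 * length (starts k)                             ∎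
  where
  open ≤-Reasoning
  N = suc (fib (3 + k))

LeftSpecial : ∀ {n} → Vec Bool n → Set
LeftSpecial x = ∀ c → Factor (c ∷ x)

module _ {n : ℕ} where
  open DecMembership (_≟ᵥ_ {suc n}) using (_∈?_)

  leftLetter : Vec Bool n → Bool
  leftLetter x = does ((true ∷ x) ∈? factors (suc n))

  leftLetter-factor : ∀ {x} → Factor x → Factor (leftLetter x ∷ x)
  leftLetter-factor {x} fac with (true ∷ x) ∈? factors (suc n)
  ... | yes ∈f = ∈-factors⁻ ∈f
  ... | no ∉f with factor-extend fac
  ...   | true  , fac′ = ⊥-elim (∉f (∈-factors⁺ fac′))
  ...   | false , fac′ = fac′

  -- Every factor extends to the left, and a left special one does so twice.
  ρ-suc : ∀ (xs : List (Vec Bool n)) → Unique xs → (∀ {x} → x ∈ xs → LeftSpecial x) →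
          ρ n + length xs ≤ ρ (suc n)
  ρ-suc xs uniq special = subst (_≤ ρ (suc n)) len (ρ-lower (map ext₁ (factors n) ++ map ext₂ xs) uniq′ fac)
    where
    ext₁ ext₂ : Vec Bool n → Vec Bool (suc n)
    ext₁ x = leftLetter x ∷ x
    ext₂ x = not (leftLetter x) ∷ x
    len : length (map ext₁ (factors n) ++ map ext₂ xs) ≡ ρ n + length xs
    len = trans (length-++ (map ext₁ (factors n)))
                (cong₂ _+_ (trans (length-map ext₁ (factors n)) (sym (ρ≡length n))) (length-map ext₂ xs))
    uniq′ : Unique (map ext₁ (factors n) ++ map ext₂ xs)
    uniq′ = Unique.++⁺ (Unique.map⁺ ∷-injectiveʳ (factors-unique n)) (Unique.map⁺ ∷-injectiveʳ uniq) disjoint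
      where
      disjoint : ∀ {v} → ¬ (v ∈ map ext₁ (factors n) × v ∈ map ext₂ xs)
      disjoint (v∈₁ , v∈₂)
        with x , _ , refl ← ∈-map⁻ ext₁ v∈₁
        with y , _ , eq ← ∈-map⁻ ext₂ v∈₂
        with refl ← ∷-injectiveʳ eq
        = not-¬ refl (∷-injectiveˡ eq)
    fac : ∀ {v} → v ∈ map ext₁ (factors n) ++ map ext₂ xs → Factor v
    fac v∈ with ∈-++⁻ (map ext₁ (factors n)) v∈
    ... | inj₁ v∈₁ with x , x∈ , refl ← ∈-map⁻ ext₁ v∈₁ = leftLetter-factor (∈-factors⁻ x∈)
    ... | inj₂ v∈₂ with x , x∈ , refl ← ∈-map⁻ ext₂ v∈₂ = special x∈ (not (leftLetter x))

-- Left special factors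

secondLast : ℕ → Bool
secondLast j = ftm (fib j ∸ 2)

2≤fib[3+_] : ∀ j → 2 ≤ fib (3 + j)
2≤fib[3+ j ] = +-mono-≤ (fib-pos (suc j)) (fib-pos j)

secondLast-2+ : ∀ j → secondLast (5 + j) ≡ not (secondLast (3 + j))
secondLast-2+ j =
  trans (cong ftm (+-∸-assoc (fib (4 + j)) 2≤fib[3+ j ]))
        (ftm-fib+ (3 + j) (∸-monoʳ-< (s≤s z≤n) 2≤fib[3+ j ]))

ending : ℕ → Bool × Bool
ending j = secondLast j , lastLetter j

ending-4+ : ∀ j → ending (7 + j) ≡ ending (3 + j)
ending-4+ j = cong₂ _,_
  (trans (secondLast-2+ (2 + j)) (trans (cong not (secondLast-2+ j)) (not-involutive _)))
  (trans (lastLetter-2+ (4 + j)) (trans (cong not (lastLetter-2+ (2 + j))) (not-involutive _)))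

-- X_3, X_4, X_5, X_6 end in 01, 11, 10, 00. The period 4 then yields arbitrarily large indices, as
-- needed for long prefixes to follow.
every-ending : ∀ n c → ∃ λ j → n ≤ j × ending (3 + j) ≡ c
every-ending zero    (false , true)  = 0 , z≤n , refl
every-ending zero    (true  , true)  = 1 , z≤n , refl
every-ending zero    (true  , false) = 2 , z≤n , refl
every-ending zero    (false , false) = 3 , z≤n , refl
every-ending (suc n) c with j , n≤j , eq ← every-ending n c =
  4 + j , s≤s (≤-trans n≤j (m≤n+m j 3)) , trans (ending-4+ j) eq

xor-cancelˡ : ∀ b c → b xor (b xor c) ≡ c
xor-cancelˡ false c = refl
xor-cancelˡ true  c = not-involutive c

not-xor-true : ∀ b → not b xor true ≡ b
not-xor-true false = refl
not-xor-true true  = refl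

-- X_{j+3} is followed by ~P. Reading this through `not b` gives `word b n 0`, so the ending sought
-- is `c`, `d` read through `not b` too.
factor-two-prefix : ∀ c d b n → Factor (c ∷ d ∷ word b n 0)
factor-two-prefix c d b n with j , n≤j , eq ← every-ending n (not b xor c , not b xor d) =
  subst Factor (cong₂ _∷_ head₁ (cong₂ _∷_ head₂ tail≡)) (factor-word (not b) (2 + n) i)
  where
  i = fib (3 + j) ∸ 2
  2+i : 2 + i ≡ fib (3 + j)
  2+i = m+[n∸m]≡n 2≤fib[3+ j ]
  head₁ : not b xor ftm i ≡ c
  head₁ = trans (cong (λ e → not b xor proj₁ e) eq) (xor-cancelˡ (not b) c)
  head₂ : not b xor ftm (suc i) ≡ d
  head₂ = trans (cong (λ m → not b xor ftm (m ∸ 1)) 2+i)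
                (trans (cong (λ e → not b xor proj₂ e) eq) (xor-cancelˡ (not b) d))
  tail≡ : word (not b) n (2 + i) ≡ word b n 0
  tail≡ = trans (match⇒word (not b) (match-cast (sym 2+i) refl
                  (match-fib (2 + j) (≤-trans (<⇒≤ (n<fib[2+n] n)) (fib-mono (+-monoʳ-≤ 2 n≤j))))))
                (cong (λ a → word a n 0) (not-xor-true b))

-- The six permanent left special factors: `nothing` is P, `just a` is P preceded by `a`, and the
-- Boolean complements P.
trunk : ∀ {n} → Maybe Bool × Bool → Vec Bool (suc n)
trunk (nothing , b) = word b _ 0
trunk (just a  , b) = a ∷ word b _ 0

trunk-special : ∀ {n} i → LeftSpecial (trunk {n} i)
trunk-special (nothing , b) c = factor-tail (factor-two-prefix false c b _)
trunk-special (just a  , b) c = factor-two-prefix c a b _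

-- `ftm` begins with 011, so the second and third letters agree in P and differ once a letter is put
-- in front.
decode : ∀ {n} → Vec Bool (3 + n) → Maybe Bool × Bool
decode (x ∷ y ∷ z ∷ _) = if y xor z then (just x , y) else (nothing , x)

decode-trunk : ∀ {n} i → decode {n} (trunk i) ≡ i
decode-trunk (nothing , false) = refl
decode-trunk (nothing , true)  = refl
decode-trunk (just a  , false) = refl
decode-trunk (just a  , true)  = refl

trunk-injective : ∀ {n i j} → trunk {2 + n} i ≡ trunk j → i ≡ j
trunk-injective {i = i} {j} eq = trans (sym (decode-trunk i)) (trans (cong decode eq) (decode-trunk j))

bits : List Bool
bits = false ∷ true ∷ []

bits-unique : Unique bits
bits-unique = ((λ ()) ∷ []) ∷ [] ∷ []

trunkIndices : List (Maybe Bool × Bool)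
trunkIndices = cartesianProduct (nothing ∷ just false ∷ just true ∷ []) bits

trunkIndices-unique : Unique trunkIndices
trunkIndices-unique = Unique.cartesianProduct⁺ (((λ ()) ∷ (λ ()) ∷ []) ∷ ((λ ()) ∷ []) ∷ [] ∷ []) bits-unique

trunks : ∀ n → List (Vec Bool (3 + n))
trunks n = map trunk trunkIndices

trunks-unique : ∀ n → Unique (trunks n)
trunks-unique n = Unique.map⁺ trunk-injective {trunkIndices} trunkIndices-unique

∈-trunks⁻ : ∀ {n x} → x ∈ trunks n → ∃ λ i → x ≡ trunk i
∈-trunks⁻ x∈ with i , _ , eq ← ∈-map⁻ trunk {xs = trunkIndices} x∈ = i , eq

ρ-suc-6 : ∀ n → ρ (3 + n) + 6 ≤ ρ (4 + n)
ρ-suc-6 n = ρ-suc (trunks n) (trunks-unique n) special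
  where
  special : ∀ {x} → x ∈ trunks n → LeftSpecial x
  special x∈ with i , refl ← ∈-trunks⁻ x∈ = trunk-special i

-- As `decode` inverts `trunk`, an extra word can only equal the trunk with its own code, so one
-- inequality per `b` excludes all six.
ρ-suc-8 : ∀ n (h : Bool → Maybe Bool) (extra : Bool → Vec Bool (3 + n)) →
          (∀ b → decode (extra b) ≡ (h b , b)) → (∀ b → extra b ≢ trunk (h b , b)) →
          (∀ b → LeftSpecial (extra b)) → ρ (3 + n) + 8 ≤ ρ (4 + n)
ρ-suc-8 n h extra dec≡ distinct special = ρ-suc (map extra bits ++ trunks n)
  (Unique.++⁺ (Unique.map⁺ extra-injective {bits} bits-unique) (trunks-unique n) disjoint)
  special′
  where
  extra-injective : ∀ {b c} → extra b ≡ extra c → b ≡ c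
  extra-injective {b} {c} eq = cong proj₂ (trans (sym (dec≡ b)) (trans (cong decode eq) (dec≡ c)))
  disjoint : ∀ {v} → ¬ (v ∈ map extra bits × v ∈ trunks n)
  disjoint (v∈₁ , v∈₂)
    with b , _ , refl ← ∈-map⁻ extra v∈₁
    with i , eq ← ∈-trunks⁻ v∈₂
    with refl ← trans (sym (dec≡ b)) (trans (cong decode eq) (decode-trunk i))
    = distinct b eq
  special′ : ∀ {x} → x ∈ map extra bits ++ trunks n → LeftSpecial x
  special′ x∈ with ∈-++⁻ (map extra bits) x∈
  ... | inj₁ x∈₁ with b , _ , refl ← ∈-map⁻ extra x∈₁ = special b
  ... | inj₂ x∈₂ with i , refl ← ∈-trunks⁻ x∈₂ = trunk-special i

leftSpecial : ∀ {n c} {x : Vec Bool n} → Factor (c ∷ x) → Factor (not c ∷ x) → LeftSpecial x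
leftSpecial {c = c} fac fac′ d with d ≟ᵇ c
... | yes refl = fac
... | no d≢c   = subst (λ e → Factor (e ∷ _)) (sym (¬-not d≢c)) fac′

-- Complementing one occurrence makes the windows equal, but makes the equal letters before them
-- different.
match-special : ∀ {n i j} → Match true n (suc i) (suc j) → ftm i ≡ ftm j → ∀ b → LeftSpecial (word b n (suc j))
match-special {n} {i} {j} p same b = leftSpecial (factor-word b (suc n) j)
  (subst Factor
    (cong₂ _∷_ (trans (cong (not b xor_) same) (sym (not-distribˡ-xor b (ftm j))))
               (trans (match⇒word (not b) p) (cong (λ a → word a n (suc j)) (not-xor-true b))))
    (factor-word (not b) (suc n) i))

-- With K = k + 3, the word at the branch point is X_K X_{K-3}, whereas ftm starts with X_K ~X_{K-1}.
branch : ℕ → ℕ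
branch k = fib (5 + k) + (fib (3 + k) + 0)

match-branch-prefix : ∀ k → Match false (fib (3 + k)) (branch k) 0
match-branch-prefix k = match-fib⁴ (suc k) 0 refl ≤-refl

-- The second occurrence of the branch word, complemented and right after X_{K+1}; the two
-- occurrences supply the two left extensions.
match-branch : ∀ k → Match true (fib (3 + k) + fib k) (fib (4 + k)) (branch k)
match-branch k = match-cast (+-identityʳ _) refl (match-overlap k 0 refl ≤-refl)

ftm-fib : ∀ j → ftm (fib (2 + j)) ≡ true
ftm-fib j = trans (cong ftm (sym (+-identityʳ (fib (2 + j))))) (ftm-fib+ (suc j) (fib-pos j))

-- With K = k + 4, the words part at offset F_K: there `ftm` has the letter 1, and by `match-branch`
-- the branch word has the complement of `ftm` at F_{K+2}, which is 0.
branch-differs : ∀ k b {n} → fib (4 + k) < n → word b n (branch (suc k)) ≢ word b n 0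
branch-differs k b {n} n> eq with
  trans (sym (xor-cancelˡ b _)) (trans (cong (b xor_) (window-injective n eq n>)) (xor-cancelˡ b _))
... | same with trans (sym (ftm-fib (4 + k)))
                  (trans (at (match-branch (suc k)) (m<m+n (fib (4 + k)) (fib-pos k)))
                         (cong not (trans same (ftm-fib (2 + k)))))
...   | ()

module _ (k : ℕ) where

  private
    K : ℕ
    K = 4 + k

    B∸ : ∀ c → c ≤ fib K → c + (fib (2 + K) + (fib K ∸ c)) ≡ branch (suc k)
    B∸ c c≤ = begin
      c + (fib (2 + K) + (fib K ∸ c)) ≡⟨ +-comm c _ ⟩
      fib (2 + K) + (fib K ∸ c) + c   ≡⟨ +-assoc (fib (2 + K)) _ c ⟩
      fib (2 + K) + (fib K ∸ c + c)   ≡⟨ cong (fib (2 + K) +_) (trans (m∸n+n≡m c≤) (sym (+-identityʳ _))) ⟩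
      branch (suc k)                  ∎
      where open ≡-Reasoning

    ftm-B∸ : ∀ c → ftm (fib (2 + K) + (fib K ∸ c)) ≡ not (ftm (fib K ∸ c))
    ftm-B∸ c = ftm-fib+ (suc K) (≤-<-trans (m∸n≤m (fib K) c) (m<m+n (fib K) (fib-pos (2 + k))))

  -- The two occurrences are preceded by the last letters of X_{K+1} and ~X_K. These are equal here,
  -- so `match-special` applies at the branch point itself.
  ρ-suc-8-even : lastLetter (suc K) ≡ not (lastLetter K) →
                 ∀ n → fib K < 3 + n → 3 + n ≤ fib K + fib (suc k) → ρ (3 + n) + 8 ≤ ρ (4 + n)
  ρ-suc-8-even last≢ n n> n≤ = ρ-suc-8 n (λ _ → nothing) (λ b → word b (3 + n) (branch (suc k)))
    (λ b → trans (cong decode (match⇒word b (match-≤ 3≤ (match-branch-prefix (suc k))))) (decode≡ b))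
    (λ b → branch-differs k b n>)
    (subst (λ m → ∀ b → LeftSpecial (word b (3 + n) m)) 1+j
      (match-special (match-cast (sym (m+[n∸m]≡n (fib-pos K))) (sym 1+j) (match-≤ n≤ (match-branch (suc k))))
        (trans last≢ (sym (ftm-B∸ 1)))))
    where
    1+j = B∸ 1 (fib-pos (3 + k))
    3≤ : 3 ≤ fib K
    3≤ = +-mono-≤ 2≤fib[3+ k ] (fib-pos (suc k))
    decode≡ : ∀ b → decode {0} (word (b xor false) 3 0) ≡ (nothing , b)
    decode≡ false = refl
    decode≡ true  = refl

  -- Here the last letters of X_{K+1} and ~X_K are complementary and only prolong the match to the
  -- left. The special word starts one place earlier, which shifts the lengths by one.
  ρ-suc-8-odd : lastLetter (suc K) ≡ lastLetter K → secondLast (suc K) ≡ not (secondLast K) →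
                ∀ n → fib K < 2 + n → 2 + n ≤ fib K + fib (suc k) → ρ (3 + n) + 8 ≤ ρ (4 + n)
  ρ-suc-8-odd last≡ second≢ n n> n≤ = ρ-suc-8 n (λ b → just (b xor ftm (suc j))) (λ b → word b (3 + n) (suc j))
    (λ b → trans (cong (λ x → decode {0} ((b xor ftm (suc j)) ∷ x))
                   (trans (cong (word b 2) 2+j) (match⇒word b (match-≤ 2≤ (match-branch-prefix (suc k))))))
                 (decode≡ b _))
    (λ b eq → branch-differs k b n> (trans (cong (word b (2 + n)) (sym 2+j)) (∷-injectiveʳ eq)))
    (match-special
      (match-++ 1 one (match-cast (sym (trans (+-comm (suc i) 1) 2+i)) (sym (trans (+-comm (suc j) 1) 2+j))
        (match-≤ n≤ (match-branch (suc k)))))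
      (trans second≢ (sym (ftm-B∸ 2))))
    where
    2≤ : 2 ≤ fib K
    2≤ = 2≤fib[3+ suc k ]
    i = fib (suc K) ∸ 2
    j = fib (2 + K) + (fib K ∸ 2)
    2+i : 2 + i ≡ fib (suc K)
    2+i = m+[n∸m]≡n 2≤fib[3+ 2 + k ]
    2+j : 2 + j ≡ branch (suc k)
    2+j = B∸ 2 2≤
    1+j : suc j ≡ fib (2 + K) + (fib K ∸ 1)
    1+j = suc-injective (trans 2+j (sym (B∸ 1 (fib-pos (3 + k)))))
    one : Match true 1 (suc i) (suc j)
    one .at {zero} _ = begin
      ftm (suc i + 0)           ≡⟨ cong ftm (trans (+-identityʳ (suc i)) (cong (_∸ 1) 2+i)) ⟩
      lastLetter (suc K)        ≡⟨ last≡ ⟩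
      lastLetter K              ≡⟨ not-involutive _ ⟨
      not (not (lastLetter K))  ≡⟨ cong not (ftm-B∸ 1) ⟨
      not (ftm (fib (2 + K) + (fib K ∸ 1))) ≡⟨ cong (λ m → not (ftm m)) (trans (sym 1+j) (sym (+-identityʳ (suc j)))) ⟩
      not (ftm (suc j + 0))     ∎
      where open ≡-Reasoning
    one .at {suc _} (s≤s ())
    decode≡ : ∀ b c → decode {0} (c ∷ word (b xor false) 2 0) ≡ (just c , b)
    decode≡ false c = refl
    decode≡ true  c = refl

-- ftmBelow k computes faster than ftm, whose recursion on ftm n starts from fib (1 + n).
samples : ∀ k n → ℕ → List (Vec Bool n)
samples k n m = map (window (ftmBelow k) n) (upTo m) ++ map (window (not ∘ ftmBelow k) n) (upTo m)

samples-factor : ∀ k {n} m {x} → m + n ≤ fib k → x ∈ samples k n m → Factor x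
samples-factor k {n} m m+n≤ x∈ with ∈-++⁻ (map (window (ftmBelow k) n) (upTo m)) x∈
... | inj₁ x∈₁ with i , i∈ , refl ← ∈-map⁻ (window (ftmBelow k) n) x∈₁ =
  i , window-cong n λ t< → ftmBelow≡ftm k (<-≤-trans (+-mono-< (∈-upTo⁻ i∈) t<) m+n≤)
... | inj₂ x∈₂ with i , i∈ , refl ← ∈-map⁻ (window (not ∘ ftmBelow k) n) x∈₂ =
  subst Factor
    (window-cong n λ t< → cong not (sym (ftmBelow≡ftm k (<-≤-trans (+-mono-< (∈-upTo⁻ i∈) t<) m+n≤))))
    (factor-word true n i)

ρ-samples : ∀ k n m → m + n ≤ fib k → length (deduplicate _≟ᵥ_ (samples k n m)) ≤ ρ n
ρ-samples k n m m+n≤ = ρ-lower (deduplicate _≟ᵥ_ (samples k n m)) (deduplicate-! _≟ᵥ_ (samples k n m))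
  (samples-factor k m m+n≤ ∘ ∈-deduplicate⁻ _≟ᵥ_ (samples k n m))

-- The base K = 5: 6 = F_5 + 1 and 30 = 8 F_5 - 2 F_4 - 4. With 49 = F_10 - 6 starting points the
-- samples evaluate to 30 distinct words.
ρ-6 : 30 ≤ ρ 6
ρ-6 = ρ-samples 10 6 49 ≤-refl

-- Squeezing ρ between the two bounds

module _ (g : ℕ → ℕ) where

  Climbs : ℕ → ℕ → ℕ → Set
  Climbs c a m = ∀ {n} → a ≤ n → n < a + m → g n + c ≤ g (suc n)

  Steps : ℕ → ℕ → ℕ → Set
  Steps c a m = ∀ {n} → a ≤ n → n < a + m → g (suc n) ≡ g n + c

  private
    climbs-init : ∀ {c a m} → Climbs c a (suc m) → Climbs c a m
    climbs-init {a = a} {m} p a≤n n< = p a≤n (<-trans n< (+-monoʳ-< a ≤-refl))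

    climbs-last : ∀ {c} a m → Climbs c a (suc m) → g (a + m) + c ≤ g (a + suc m)
    climbs-last {c} a m p = subst (λ j → g (a + m) + c ≤ g j) (sym (+-suc a m)) (p (m≤m+n a m) (+-monoʳ-< a ≤-refl))

    shuffle : ∀ x c y → x + (c + y) ≡ x + y + c
    shuffle x c y = trans (cong (x +_) (+-comm c y)) (sym (+-assoc x y c))

  climb : ∀ {c} a m → Climbs c a m → g a + m * c ≤ g (a + m)
  climb a zero p = ≤-reflexive (trans (+-identityʳ _) (cong g (sym (+-identityʳ a))))
  climb {c} a (suc m) p = begin
    g a + (c + m * c)  ≡⟨ shuffle (g a) c (m * c) ⟩
    g a + m * c + c    ≤⟨ +-monoˡ-≤ c (climb a m (climbs-init p)) ⟩
    g (a + m) + c      ≤⟨ climbs-last a m p ⟩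
    g (a + suc m)      ∎
    where open ≤-Reasoning

  -- When the minimal increments already exhaust the total rise, no single step has slack.
  tight : ∀ {c} a m → Climbs c a m → g (a + m) ≤ g a + m * c → Steps c a m
  tight a zero p upper a≤n n< = ⊥-elim (<⇒≱ n< (subst (_≤ _) (sym (+-identityʳ a)) a≤n))
  tight {c} a (suc m) p upper {n} a≤n n< with m≤n⇒m<n∨m≡n (≤-pred (subst (n <_) (+-suc a m) n<))
  ... | inj₁ n<a+m = tight a m (climbs-init p) upper′ a≤n n<a+m
    where
    upper′ : g (a + m) ≤ g a + m * c
    upper′ = +-cancelʳ-≤ c _ _ (≤-trans (climbs-last a m p) (≤-trans upper (≤-reflexive (shuffle (g a) c (m * c)))))
  ... | inj₂ refl = ≤-antisym (begin
    g (suc (a + m))    ≡⟨ cong g (+-suc a m) ⟨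
    g (a + suc m)      ≤⟨ upper ⟩
    g a + (c + m * c)  ≡⟨ shuffle (g a) c (m * c) ⟩
    g a + m * c + c    ≤⟨ +-monoˡ-≤ c (climb a m (climbs-init p)) ⟩
    g (a + m) + c      ∎) (p a≤n n<)
    where open ≤-Reasoning

  module _ {c d e} a x y z (p : Climbs c a x) (q : Climbs d (a + x) y) (r : Climbs e (a + x + y) z) where

    private
      lx : g a + x * c ≤ g (a + x)
      lx = climb a x p
      ly : g (a + x) + y * d ≤ g (a + x + y)
      ly = climb (a + x) y q
      lz : g (a + x + y) + z * e ≤ g (a + x + y + z)
      lz = climb (a + x + y) z r

    climb₃ : g a + x * c + y * d + z * e ≤ g (a + x + y + z)
    climb₃ = ≤-trans (+-monoˡ-≤ (z * e) (≤-trans (+-monoˡ-≤ (y * d) lx) ly)) lz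

    -- Each stretch inherits an upper bound from the total by cancelling the lower bounds of the
    -- other two.
    tight₃ : g (a + x + y + z) ≤ g a + x * c + y * d + z * e →
             Steps c a x × Steps d (a + x) y × Steps e (a + x + y) z
    tight₃ upper = tight a x p ux , tight (a + x) y q uy , tight (a + x + y) z r uz
      where
      uz : g (a + x + y + z) ≤ g (a + x + y) + z * e
      uz = ≤-trans upper (+-monoˡ-≤ (z * e) (≤-trans (+-monoˡ-≤ (y * d) lx) ly))
      uxy : g (a + x + y) ≤ g a + x * c + y * d
      uxy = +-cancelʳ-≤ (z * e) _ _ (≤-trans lz upper)
      uy : g (a + x + y) ≤ g (a + x) + y * d
      uy = ≤-trans uxy (+-monoˡ-≤ (y * d) lx)
      ux : g (a + x) ≤ g a + x * c
      ux = +-cancelʳ-≤ (y * d) _ _ (≤-trans ly uxy)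

-- The value of ρ (F_K + 1) for K = k + 3 ≥ 5.
bound : ℕ → ℕ
bound k = 2 * length (starts k)

-- The F_{K-1} steps from F_K + 1 to F_{K+1} + 1 consist of F_{K-3} eights and F_{K-2} sixes. Adding
-- 4 on both sides lets `length-starts` apply.
bound-suc : ∀ k → bound (suc k) ≡ bound k + fib k * 8 + fib (suc k) * 6
bound-suc k = +-cancelˡ-≡ 4 _ _ (begin
  4 + bound (suc k)                               ≡⟨ double (length (starts (suc k))) ⟩
  2 * (2 + length (starts (suc k)))               ≡⟨ cong (2 *_) (length-starts (suc k)) ⟩
  2 * (2 * fib (4 + k) + 2 * fib (2 + k) + fib (3 + k)) ≡⟨ rearrange (fib k) (fib (suc k)) ⟩
  2 * (2 * fib (3 + k) + 2 * fib (suc k) + fib (2 + k)) + fib k * 8 + fib (suc k) * 6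
    ≡⟨ cong (λ l → 2 * l + fib k * 8 + fib (suc k) * 6) (length-starts k) ⟨
  2 * (2 + length (starts k)) + fib k * 8 + fib (suc k) * 6
    ≡⟨ cong (λ l → l + fib k * 8 + fib (suc k) * 6) (double (length (starts k))) ⟨
  4 + bound k + fib k * 8 + fib (suc k) * 6       ∎)
  where
  open ≡-Reasoning
  open +-*-Solver
  double : ∀ l → 4 + 2 * l ≡ 2 * (2 + l)
  double = solve 1 (λ l → con 4 :+ con 2 :* l := con 2 :* (con 2 :+ l)) refl
  rearrange : ∀ a b → 2 * (2 * (b + a + b + (b + a)) + 2 * (b + a) + (b + a + b))
                    ≡ 2 * (2 * (b + a + b) + 2 * b + (b + a)) + a * 8 + b * 6
  rearrange = solve 2 (λ a b →
    con 2 :* (con 2 :* (b :+ a :+ b :+ (b :+ a)) :+ con 2 :* (b :+ a) :+ (b :+ a :+ b))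
    := con 2 :* (con 2 :* (b :+ a :+ b) :+ con 2 :* b :+ (b :+ a)) :+ a :* con 8 :+ b :* con 6) refl

climbs-6 : ∀ a m → 3 ≤ a → Climbs ρ 6 a m
climbs-6 a m 3≤a a≤n _ with s≤s (s≤s (s≤s {n = n} _)) ← ≤-trans 3≤a a≤n = ρ-suc-6 n

3≤1+fib : ∀ k → 3 ≤ suc (fib (3 + k))
3≤1+fib k = s≤s 2≤fib[3+ k ]

-- The two parities of K.

lastLetter-odd : ∀ e → lastLetter (2 + e * 2) ≡ lastLetter (1 + e * 2)
lastLetter-odd zero    = refl
lastLetter-odd (suc e) = trans (lastLetter-2+ (1 + e * 2)) (trans (cong not (lastLetter-odd e)) (sym (lastLetter-2+ (e * 2))))

lastLetter-even : ∀ e → lastLetter (3 + e * 2) ≡ not (lastLetter (2 + e * 2))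
lastLetter-even e = trans (lastLetter-2+ (e * 2)) (cong not (sym (lastLetter-odd e)))

secondLast-odd : ∀ e → secondLast (4 + e * 2) ≡ not (secondLast (3 + e * 2))
secondLast-odd zero    = refl
secondLast-odd (suc e) = trans (secondLast-2+ (1 + e * 2)) (cong not (trans (secondLast-odd e) (sym (secondLast-2+ (e * 2)))))

-- The lower bounds on the increments over F_K + 1 ≤ n ≤ F_{K+1}, where K = k + 3, add up to bound (suc k) ∸ bound k.
module Cycle (k x z : ℕ) (x+z : x + z ≡ fib (suc k))
             (climbs : Climbs ρ 8 (suc (fib (3 + k)) + x) (fib k)) where

  private
    a : ℕ
    a = suc (fib (3 + k))

    end : a + x + fib k + z ≡ suc (fib (4 + k))
    end = trans (solve 4 (λ f g x z → con 1 :+ f :+ x :+ g :+ z := con 1 :+ (f :+ ((x :+ z) :+ g))) refl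
                  (fib (3 + k)) (fib k) x z)
                (cong (λ y → suc (fib (3 + k) + (y + fib k))) x+z)
      where open +-*-Solver

    total : ∀ r → r + x * 6 + fib k * 8 + z * 6 ≡ r + fib k * 8 + fib (suc k) * 6
    total r = trans (solve 4 (λ r g x z → r :+ x :* con 6 :+ g :* con 8 :+ z :* con 6
                                       := r :+ g :* con 8 :+ (x :+ z) :* con 6) refl r (fib k) x z)
                    (cong (λ y → r + fib k * 8 + y * 6) x+z)
      where open +-*-Solver

    climbs₁ : Climbs ρ 6 a x
    climbs₁ = climbs-6 a x (3≤1+fib k)

    climbs₃ : Climbs ρ 6 (a + x + fib k) z
    climbs₃ = climbs-6 _ z (≤-trans (3≤1+fib k) (≤-trans (m≤m+n a x) (m≤m+n _ (fib k))))

  lower-suc : bound k ≤ ρ a → bound (suc k) ≤ ρ (suc (fib (4 + k)))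
  lower-suc lower = begin
    bound (suc k)                             ≡⟨ bound-suc k ⟩
    bound k + fib k * 8 + fib (suc k) * 6     ≡⟨ total (bound k) ⟨
    bound k + x * 6 + fib k * 8 + z * 6       ≤⟨ +-monoˡ-≤ (z * 6) (+-monoˡ-≤ (fib k * 8) (+-monoˡ-≤ (x * 6) lower)) ⟩
    ρ a + x * 6 + fib k * 8 + z * 6           ≤⟨ climb₃ ρ {6} {8} {6} a x (fib k) z climbs₁ climbs climbs₃ ⟩
    ρ (a + x + fib k + z)                     ≡⟨ cong ρ end ⟩
    ρ (suc (fib (4 + k)))                     ∎
    where open ≤-Reasoning

  steps : bound k ≤ ρ a → Steps ρ 6 a x × Steps ρ 8 (a + x) (fib k) × Steps ρ 6 (a + x + fib k) z
  steps lower = tight₃ ρ {6} {8} {6} a x (fib k) z climbs₁ climbs climbs₃ (begin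
    ρ (a + x + fib k + z)                     ≡⟨ cong ρ end ⟩
    ρ (suc (fib (4 + k)))                     ≤⟨ ρ-upper (suc k) ⟩
    bound (suc k)                             ≡⟨ bound-suc k ⟩
    bound k + fib k * 8 + fib (suc k) * 6     ≤⟨ +-monoˡ-≤ (fib (suc k) * 6) (+-monoˡ-≤ (fib k * 8) lower) ⟩
    ρ a + fib k * 8 + fib (suc k) * 6         ≡⟨ total (ρ a) ⟨
    ρ a + x * 6 + fib k * 8 + z * 6           ∎)
    where open ≤-Reasoning

-- For odd K the eights begin at F_K + 2, since the special word includes the letter before the
-- branch point.
climbs-odd : ∀ e → Climbs ρ 8 (suc (fib (5 + e * 2)) + 1) (fib (2 + e * 2))
climbs-odd e {n} ≤n n<
  with n | subst (_≤ n) (+-comm (suc (fib (5 + e * 2))) 1) ≤n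
         | subst (λ j → n < j + fib (2 + e * 2)) (+-comm (suc (fib (5 + e * 2))) 1) n<
-- Length 2 would force F_K ≤ 0.
... | suc (suc zero)     | s≤s (s≤s ≤0) | _  = ⊥-elim (<⇒≱ (fib-pos (4 + e * 2)) ≤0)
... | suc (suc (suc n′)) | s≤s ≤n′      | s≤s (s≤s n′≤) =
  ρ-suc-8-odd (1 + e * 2) (lastLetter-odd (2 + e)) (secondLast-odd (1 + e)) n′ ≤n′ n′≤

climbs-even : ∀ e → Climbs ρ 8 (suc (fib (6 + e * 2)) + 0) (fib (3 + e * 2))
climbs-even e {n} ≤n n<
  with n | ≤-trans (3≤1+fib (3 + e * 2)) (≤-trans (m≤m+n _ 0) ≤n)
         | subst (_≤ n) (+-identityʳ (suc (fib (6 + e * 2)))) ≤n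
         | subst (λ j → n < j + fib (3 + e * 2)) (+-identityʳ (suc (fib (6 + e * 2)))) n<
... | suc (suc (suc n′)) | s≤s (s≤s (s≤s _)) | ≤n′ | s≤s n′≤ =
  ρ-suc-8-even (2 + e * 2) (lastLetter-even (2 + e)) n′ ≤n′ n′≤

module Odd (e : ℕ) =
  Cycle (2 + e * 2) 1 (fib (3 + e * 2) ∸ 1) (m+[n∸m]≡n (fib-pos (2 + e * 2))) (climbs-odd e)

module Even (e : ℕ) = Cycle (3 + e * 2) 0 (fib (4 + e * 2)) refl (climbs-even e)

-- Starting from `ρ-6`, an odd and an even cycle carry the lower bound from K to K+2.
ρ-lower-odd : ∀ e → bound (2 + e * 2) ≤ ρ (suc (fib (5 + e * 2)))
ρ-lower-odd zero    = ρ-6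
ρ-lower-odd (suc e) = Even.lower-suc e (Odd.lower-suc e (ρ-lower-odd e))

ρ-lower-even : ∀ e → bound (3 + e * 2) ≤ ρ (suc (fib (6 + e * 2)))
ρ-lower-even e = Odd.lower-suc e (ρ-lower-odd e)

-- The four ranges.

module _ (e : ℕ) where

  private
    K : ℕ
    K = 5 + e * 2
    odd  = Odd.steps e (ρ-lower-odd e)
    even = Even.steps e (ρ-lower-even e)
    next = Odd.steps (suc e) (ρ-lower-odd (suc e))

  range₁ : ∀ n → fib K + 2 ≤ n → n ≤ fib K + fib (2 + e * 2) + 1 → DiffEq n 8
  range₁ n lo hi = diffEq n (proj₁ (proj₂ odd) (subst (_≤ n) eq₁ lo) (subst (n <_) eq₂ (s≤s hi)))
    where
    open +-*-Solver
    eq₁ = solve 1 (λ f → f :+ con 2 := con 1 :+ f :+ con 1) refl (fib K)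
    eq₂ = solve 2 (λ f g → con 1 :+ (f :+ g :+ con 1) := con 1 :+ f :+ con 1 :+ g) refl (fib K) (fib (2 + e * 2))

  range₂ : ∀ n → fib K + fib (2 + e * 2) + 2 ≤ n → n ≤ fib (suc K) → DiffEq n 6
  range₂ n lo hi = diffEq n (proj₂ (proj₂ odd) (subst (_≤ n) eq₁ lo) (subst (n <_) eq₂ (s≤s hi)))
    where
    open +-*-Solver
    z = fib (3 + e * 2) ∸ 1
    eq₁ = solve 2 (λ f g → f :+ g :+ con 2 := con 1 :+ f :+ con 1 :+ g) refl (fib K) (fib (2 + e * 2))
    eq₂ : suc (fib (suc K)) ≡ suc (fib K) + 1 + fib (2 + e * 2) + z
    eq₂ = trans (cong (λ y → suc (fib K + (y + fib (2 + e * 2)))) (sym (m+[n∸m]≡n (fib-pos (2 + e * 2)))))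
                (solve 3 (λ f g z → con 1 :+ (f :+ (con 1 :+ z :+ g)) := con 1 :+ f :+ con 1 :+ g :+ z) refl
                  (fib K) (fib (2 + e * 2)) z)

  range₃ : ∀ n → fib (suc K) + 1 ≤ n → n ≤ fib (suc K) + fib (3 + e * 2) → DiffEq n 8
  range₃ n lo hi = diffEq n (proj₁ (proj₂ even) (subst (_≤ n) eq₁ lo) (subst (n <_) eq₂ (s≤s hi)))
    where
    open +-*-Solver
    eq₁ = solve 1 (λ f → f :+ con 1 := con 1 :+ f :+ con 0) refl (fib (suc K))
    eq₂ = solve 2 (λ f g → con 1 :+ (f :+ g) := con 1 :+ f :+ con 0 :+ g) refl (fib (suc K)) (fib (3 + e * 2))

  range₄ : ∀ n → fib (suc K) + fib (3 + e * 2) + 1 ≤ n → n ≤ fib (2 + K) + 1 → DiffEq n 6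
  range₄ n lo hi with n ≤? fib (2 + K)
  ... | yes hi′ = diffEq n (proj₂ (proj₂ even) (subst (_≤ n) eq₁ lo) (subst (n <_) eq₂ (s≤s hi′)))
    where
    open +-*-Solver
    eq₁ = solve 2 (λ f g → f :+ g :+ con 1 := con 1 :+ f :+ con 0 :+ g) refl (fib (suc K)) (fib (3 + e * 2))
    eq₂ = solve 3 (λ f g h → con 1 :+ (f :+ (h :+ g)) := con 1 :+ f :+ con 0 :+ g :+ h) refl
            (fib (suc K)) (fib (3 + e * 2)) (fib (4 + e * 2))
  -- The last value F_{K+2} + 1 belongs to the next odd cycle, whose first stretch of sixes has
  -- length 1.
  ... | no n≰ = diffEq n (proj₁ next (≰⇒> n≰) (s≤s hi))

theorem2 : (m : ℕ) → 2 ≤ m →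
    ((n : ℕ) → fib (2 * m + 1) + 2 ≤ n → n ≤ fib (2 * m + 1) + fib (2 * m ∸ 2) + 1 → DiffEq n 8) ×
    ((n : ℕ) → fib (2 * m + 1) + fib (2 * m ∸ 2) + 2 ≤ n → n ≤ fib (2 * m + 2) → DiffEq n 6) ×
    ((n : ℕ) → fib (2 * m + 2) + 1 ≤ n → n ≤ fib (2 * m + 2) + fib (2 * m ∸ 1) → DiffEq n 8) ×
    ((n : ℕ) → fib (2 * m + 2) + fib (2 * m ∸ 1) + 1 ≤ n → n ≤ fib (2 * m + 3) + 1 → DiffEq n 6)
-- With m = e + 2 the odd cycle has K = 2m + 1. In `ranges` the indices are variables, so that
-- matching on `refl` normalises them.
theorem2 (suc (suc e)) _ = ranges (double+ 1) (double+ 2) (double+ 3) (cong (_∸ 2) double) (cong (_∸ 1) double)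
  where
  double : 2 * (2 + e) ≡ 4 + e * 2
  double = *-comm 2 (2 + e)
  double+ : ∀ c → 2 * (2 + e) + c ≡ c + (4 + e * 2)
  double+ c = trans (+-comm _ c) (cong (c +_) double)
  ranges : ∀ {i₁ i₂ i₃ j₂ j₁} →
    i₁ ≡ 5 + e * 2 → i₂ ≡ 6 + e * 2 → i₃ ≡ 7 + e * 2 → j₂ ≡ 2 + e * 2 → j₁ ≡ 3 + e * 2 →
    ((n : ℕ) → fib i₁ + 2 ≤ n → n ≤ fib i₁ + fib j₂ + 1 → DiffEq n 8) ×
    ((n : ℕ) → fib i₁ + fib j₂ + 2 ≤ n → n ≤ fib i₂ → DiffEq n 6) ×
    ((n : ℕ) → fib i₂ + 1 ≤ n → n ≤ fib i₂ + fib j₁ → DiffEq n 8) ×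
    ((n : ℕ) → fib i₂ + fib j₁ + 1 ≤ n → n ≤ fib i₃ + 1 → DiffEq n 6)
  ranges refl refl refl refl refl = range₁ e , range₂ e , range₃ e , range₄ e
theorem2 (suc zero) (s≤s ())
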